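{- For every $m\ge 3$, the Sperner systems $\mathcal{M}^m_1$ and $\mathcal{M}^m_2$ are nonisomorphic.
   Context: A set system over a finite set $A$ (the ground set) is a set of subsets of $A$, called blocks; it is a Sperner system if no block is included in another. Set systems $\mathcal A$ over $A$ and $\mathcal B$ over $B$ are isomorphic if there is a bijection $\sigma\colon A\to B$ with $\{\sigma(S):S\in\mathcal A\}=\mathcal B$. Let $[m]=\{1,\dots,m\}$. For each $n\in[m]$ let $n'$ be a new element (a primed copy of $n$), and $S'=\{n':n\in S\}$ for $S\subseteq[m]$. Let $E_m=[m]\cup[m]'$, a set with $2m$ elements. Addition of elements of $[m]$ is modulo $m$ with result taken in $[m]$. For $J\subseteq[m]$ let $F^m_J=J\cup([m]\setminus J)'$. Put $\mathcal F^m_1=\{F^m_J: J\subseteq[m],\ |J|\text{ odd}\}$ and $\mathcal F^m_2=\{F^m_J: J\subseteq[m],\ |J|\text{ even}\}$. For $p\in[m]$ let $G^m_p=E_m\setminus\{p,p',(p+1)'\}$ and $\mathcal G^m=\{G^m_p:p\in[m]\}$. For $i\in\{1,2\}$, $\mathcal M^m_i=\mathcal F^m_i\cup\mathcal G^m$, a Sperner system over $E_m$. -}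

module Defs where

open import Data.Fin.Base using (Fin; zero; suc; toℕ; splitAt; _↑ˡ_; _↑ʳ_)
open import Data.Fin.Properties using (_≟_; any?; ↑ˡ-injective; ↑ʳ-injective; splitAt-↑ˡ; splitAt-↑ʳ)
open import Data.Fin.Subset using (Subset; _∈_; _∉_; _⊆_; _⊈_; ⊤; ∁; ⁅_⁆; _-_; ∣_∣)
open import Data.Fin.Subset.Properties
  using (_∈?_; ∈⊤; ⊆-antisym; ∁p⊆∁q⇒p⊇q; x∈p∧x≢y⇒x∈p-y; x∉p⇒x∈∁p; x∈∁p⇒x∉p; p─q⊆p)
open import Data.Nat.Base using (ℕ; suc; _+_; _≤_; s≤s)
open import Data.Nat.Divisibility using (_∣_; _∤_)
open import Data.Nat.DivMod using (_mod_)
open import Data.Product.Base using (∃; ∃-syntax; _×_; _,_)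
open import Data.Sum.Base using (inj₁; inj₂)
open import Data.Vec.Base using (_∷_; _++_; tabulate; there)
open import Data.Vec.Properties
  using (lookup-++ˡ; lookup-++ʳ; []=⇒lookup; lookup⇒[]=; lookup∘tabulate)
open import Function.Base using (_∘_)
open import Function.Bundles using (_⤖_; _⇔_; mk⇔; Bijection)
open import Level using (0ℓ)
open import Relation.Binary.PropositionalEquality
  using (_≡_; _≢_; refl; sym; trans; cong)
open import Relation.Nullary.Decidable
  using (Dec; yes; no; does; _×-dec_; dec-true)
open import Relation.Nullary.Negation using (contradiction)
open import Relation.Unary using (Pred; _≐_; _∪_) renaming (_∈_ to _∈ₛ_)

-- The ground set of size n is Fin n; equality of blocks is _≡_ on Subset n.
SetSystem : ℕ → Set₁
SetSystem n = Pred (Subset n) 0ℓ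

IsSperner : ∀ {n} → SetSystem n → Set
IsSperner 𝒜 = ∀ {S T} → S ∈ₛ 𝒜 → T ∈ₛ 𝒜 → S ⊆ T → S ≡ T

image : ∀ {n k} → (Fin n → Fin k) → Subset n → Subset k
image f S = tabulate λ y → does (any? λ x → (x ∈? S) ×-dec (f x ≟ y))

∈-image : ∀ {n k} (f : Fin n → Fin k) (S : Subset n) {y : Fin k} →
          y ∈ image f S ⇔ (∃[ x ] x ∈ S × f x ≡ y)
∈-image {n} {k} f S {y} = mk⇔ to from
  where
  dec : ∀ y → Dec (∃[ x ] x ∈ S × f x ≡ y)
  dec y = any? λ x → (x ∈? S) ×-dec (f x ≟ y)

  to : y ∈ image f S → ∃[ x ] x ∈ S × f x ≡ y
  to y∈ with dec y | trans (sym (lookup∘tabulate (does ∘ dec) y)) ([]=⇒lookup y∈)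
  ... | yes w | _ = w
  ... | no  _ | ()

  from : (∃[ x ] x ∈ S × f x ≡ y) → y ∈ image f S
  from w = lookup⇒[]= y _ (trans (lookup∘tabulate (does ∘ dec) y) (dec-true (dec y) w))

imageSystem : ∀ {n k} → (Fin n → Fin k) → SetSystem n → SetSystem k
imageSystem f 𝒜 T = ∃[ S ] S ∈ₛ 𝒜 × image f S ≡ T

Isomorphic : ∀ {n k} → SetSystem n → SetSystem k → Set
Isomorphic {n} {k} 𝒜 ℬ =
  ∃ λ (σ : Fin n ⤖ Fin k) → imageSystem (Bijection.to σ) 𝒜 ≐ ℬ

-- [m] is Fin m, with index i standing for the element i + 1, and E_m is
-- Fin (m + m): the first m indices are [m], the last m are the primed copies.
-- Accordingly S ++ T : Subset (m + m) is S ∪ T′.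
orig : ∀ {m} → Fin m → Fin (m + m)
orig {m} p = p ↑ˡ m

primed : ∀ {m} → Fin m → Fin (m + m)
primed {m} p = m ↑ʳ p

-- p ↦ p + 1 modulo m; the shift of indices by one does not affect this map.
next : ∀ {m} → Fin m → Fin m
next {suc n} p = suc (toℕ p) mod suc n

F : ∀ {m} → Subset m → Subset (m + m)
F J = J ++ ∁ J

G : ∀ {m} → Fin m → Subset (m + m)
G p = ⊤ - orig p - primed p - primed (next p)

𝓕₁ 𝓕₂ 𝓖 𝓜₁ 𝓜₂ : ∀ m → SetSystem (m + m)
𝓕₁ m S = ∃ λ (J : Subset m) → 2 ∤ ∣ J ∣ × S ≡ F J
𝓕₂ m S = ∃ λ (J : Subset m) → 2 ∣ ∣ J ∣ × S ≡ F J
𝓖  m S = ∃ λ (p : Fin m) → S ≡ G p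
𝓜₁ m = 𝓕₁ m ∪ 𝓖 m
𝓜₂ m = 𝓕₂ m ∪ 𝓖 m

private
  orig≢primed : ∀ {m} (p q : Fin m) → orig p ≢ primed q
  orig≢primed {m} p q eq
    with () ← trans (sym (splitAt-↑ˡ m p m))
                    (trans (cong (splitAt m) eq) (splitAt-↑ʳ m m q))

  orig∈++⁺ : ∀ {m} (S T : Subset m) {p} → p ∈ S → orig p ∈ S ++ T
  orig∈++⁺ S T {p} p∈ = lookup⇒[]= _ _ (trans (lookup-++ˡ S T p) ([]=⇒lookup p∈))

  orig∈++⁻ : ∀ {m} (S T : Subset m) {p} → orig p ∈ S ++ T → p ∈ S
  orig∈++⁻ S T {p} p∈ = lookup⇒[]= _ _ (trans (sym (lookup-++ˡ S T p)) ([]=⇒lookup p∈))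

  primed∈++⁺ : ∀ {m} (S T : Subset m) {p} → p ∈ T → primed p ∈ S ++ T
  primed∈++⁺ S T {p} p∈ = lookup⇒[]= _ _ (trans (lookup-++ʳ S T p) ([]=⇒lookup p∈))

  primed∈++⁻ : ∀ {m} (S T : Subset m) {p} → primed p ∈ S ++ T → p ∈ T
  primed∈++⁻ S T {p} p∈ = lookup⇒[]= _ _ (trans (sym (lookup-++ʳ S T p)) ([]=⇒lookup p∈))

  x∉p-x : ∀ {n} (p : Subset n) x → x ∉ p - x
  x∉p-x (_ ∷ _) zero    ()
  x∉p-x (_ ∷ p) (suc x) (there x∈) = x∉p-x p x x∈

  p-y⊆p : ∀ {n} (p : Subset n) y → p - y ⊆ p
  p-y⊆p p y = p─q⊆p p ⁅ y ⁆

  orig∈G : ∀ {m} {p q : Fin m} → q ≢ p → orig q ∈ G p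
  orig∈G {m} {p} {q} q≢p =
    x∈p∧x≢y⇒x∈p-y (x∈p∧x≢y⇒x∈p-y (x∈p∧x≢y⇒x∈p-y ∈⊤
      (q≢p ∘ ↑ˡ-injective m q p)) (orig≢primed q p)) (orig≢primed q (next p))

  primed∈G : ∀ {m} {p q : Fin m} → q ≢ p → q ≢ next p → primed q ∈ G p
  primed∈G {m} {p} {q} q≢p q≢p+1 =
    x∈p∧x≢y⇒x∈p-y (x∈p∧x≢y⇒x∈p-y (x∈p∧x≢y⇒x∈p-y ∈⊤
      (orig≢primed p q ∘ sym)) (q≢p ∘ ↑ʳ-injective m q p)) (q≢p+1 ∘ ↑ʳ-injective m q (next p))

  primed∉G : ∀ {m} (p : Fin m) → primed p ∉ G p
  primed∉G p = x∉p-x (⊤ - orig p) (primed p) ∘ p-y⊆p (⊤ - orig p - primed p) (primed (next p))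

  orig∉G : ∀ {m} (p : Fin m) → orig p ∉ G p
  orig∉G p = x∉p-x ⊤ (orig p) ∘ p-y⊆p (⊤ - orig p) (primed p)
           ∘ p-y⊆p (⊤ - orig p - primed p) (primed (next p))

  avoid : ∀ {m} → 3 ≤ m → (a b : Fin m) → ∃[ q ] q ≢ a × q ≢ b
  avoid (s≤s (s≤s (s≤s _))) zero    zero          = suc zero , (λ ()) , (λ ())
  avoid (s≤s (s≤s (s≤s _))) zero    (suc zero)    = suc (suc zero) , (λ ()) , (λ ())
  avoid (s≤s (s≤s (s≤s _))) zero    (suc (suc _)) = suc zero , (λ ()) , (λ ())
  avoid (s≤s (s≤s (s≤s _))) (suc zero)    zero    = suc (suc zero) , (λ ()) , (λ ())
  avoid (s≤s (s≤s (s≤s _))) (suc (suc _)) zero    = suc zero , (λ ()) , (λ ())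
  avoid (s≤s (s≤s (s≤s _))) (suc _) (suc _)       = zero , (λ ()) , (λ ())

  F⊆F : ∀ {m} (J K : Subset m) → F J ⊆ F K → J ≡ K
  F⊆F J K F⊆ = ⊆-antisym
    (orig∈++⁻ K (∁ K) ∘ F⊆ ∘ orig∈++⁺ J (∁ J))
    (∁p⊆∁q⇒p⊇q (primed∈++⁻ K (∁ K) ∘ F⊆ ∘ primed∈++⁺ J (∁ J)))

  F⊈G : ∀ {m} (J : Subset m) p → F J ⊈ G p
  F⊈G J p F⊆G with p ∈? J
  ... | yes p∈J = orig∉G p (F⊆G (orig∈++⁺ J (∁ J) p∈J))
  ... | no  p∉J = primed∉G p (F⊆G (primed∈++⁺ J (∁ J) (x∉p⇒x∈∁p p∉J)))

  G⊈F : ∀ {m} → 3 ≤ m → ∀ p (J : Subset m) → G p ⊈ F J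
  G⊈F 3≤m p J G⊆F with avoid 3≤m p (next p)
  ... | q , q≢p , q≢p+1 =
    x∈∁p⇒x∉p (primed∈++⁻ J (∁ J) (G⊆F (primed∈G q≢p q≢p+1)))
             (orig∈++⁻ J (∁ J) (G⊆F (orig∈G q≢p)))

  G⊆G : ∀ {m} (p q : Fin m) → G p ⊆ G q → G p ≡ G q
  G⊆G p q G⊆ with q ≟ p
  ... | yes refl = refl
  ... | no  q≢p  = contradiction (G⊆ (orig∈G q≢p)) (orig∉G q)

𝓜₁-isSperner : ∀ {m} → 3 ≤ m → IsSperner (𝓜₁ m)
𝓜₁-isSperner 3≤m (inj₁ (J , _ , refl)) (inj₁ (K , _ , refl)) = cong F ∘ F⊆F J K
𝓜₁-isSperner 3≤m (inj₁ (J , _ , refl)) (inj₂ (q , refl)) S⊆T = contradiction (λ {x} → S⊆T {x}) (F⊈G J q)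
𝓜₁-isSperner 3≤m (inj₂ (p , refl)) (inj₁ (K , _ , refl)) S⊆T = contradiction (λ {x} → S⊆T {x}) (G⊈F 3≤m p K)
𝓜₁-isSperner 3≤m (inj₂ (p , refl)) (inj₂ (q , refl)) = G⊆G p q

𝓜₂-isSperner : ∀ {m} → 3 ≤ m → IsSperner (𝓜₂ m)
𝓜₂-isSperner 3≤m (inj₁ (J , _ , refl)) (inj₁ (K , _ , refl)) = cong F ∘ F⊆F J K
𝓜₂-isSperner 3≤m (inj₁ (J , _ , refl)) (inj₂ (q , refl)) S⊆T = contradiction (λ {x} → S⊆T {x}) (F⊈G J q)
𝓜₂-isSperner 3≤m (inj₂ (p , refl)) (inj₁ (K , _ , refl)) S⊆T = contradiction (λ {x} → S⊆T {x}) (G⊈F 3≤m p K)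
𝓜₂-isSperner 3≤m (inj₂ (p , refl)) (inj₂ (q , refl)) = G⊆G p q

{-# OPTIONS --safe #-}
-- The number of blocks avoiding an element separates [m] from [m]′. Every element
-- of E_m is avoided by the same number 2^(m-2) of blocks F_J: once it is fixed
-- whether p ∈ J, all but one of the other elements of J can be chosen freely, and
-- the last one is dictated by the parity of |J|. Of the blocks in 𝓖, only G_p avoids
-- p, whereas both G_p and G_(p-1) avoid p′. So an isomorphism σ : 𝓜₁ → 𝓜₂ maps [m]′
-- to [m]′ by the pigeonhole principle, and then [m] to [m] by injectivity. The block
-- {1} ∪ ([m] ∖ {1})′ of 𝓜₁ thus goes to a block of 𝓜₂ with exactly one element in
-- [m]; but such a block is not some F_J with |J| even, and not some G_p either, as
-- |G_p ∩ [m]| = m-1 ≥ 2.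
module Submission where

open import Defs
open import Data.Nat.Base using (ℕ; _≤_)
open import Relation.Nullary.Negation using (¬_)

open import Data.Bool.Base using (Bool)
open import Data.Fin.Base
  using (Fin; zero; suc; toℕ; fromℕ; inject₁; punchIn; splitAt)
open import Data.Fin.Patterns using (0F; 1F)
open import Data.Fin.Properties
  using ( toℕ-injective; toℕ-fromℕ; toℕ-fromℕ<; toℕ-inject₁; toℕ<n; 2↔Bool; *↔×
        ; injective⇒≤; punchIn-injective; punchInᵢ≢i; suc-injective; _≟_
        ; ↑ˡ-injective; ↑ʳ-injective; splitAt-↑ˡ; splitAt-↑ʳ; splitAt⁻¹-↑ˡ; splitAt⁻¹-↑ʳ )
open import Data.Fin.Subset
  using (Subset; inside; outside; _∈_; _∉_; _⊆_; ⊤; ∁; ⁅_⁆; _-_; ∣_∣)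
open import Data.Fin.Subset.Properties
  using ( _∈?_; ∈⊤; ⊆-antisym; x∈p∧x≢y⇒x∈p-y; x∉p⇒x∈∁p; x∈∁p⇒x∉p; p─q⊆p
        ; x∈⁅x⁆; x∈⁅y⁆⇒x≡y; ∣⁅x⁆∣≡1 )
open import Data.Nat.Base using (suc; _+_; _^_; s≤s)
open import Data.Nat.Divisibility
  using (_∣_; _∤_; _∣?_; ∣-refl; _∣0; ∣m∣n⇒∣m+n; ∣m+n∣m⇒∣n; ∣1⇒≡1)
open import Data.Nat.DivMod using (m%n<n; n%n≡0; m<n⇒m%n≡m; _%_)
open import Data.Nat.Properties using (+-comm; ≤-reflexive; 1+n≰n)
open import Data.Product.Base using (∃; ∃-syntax; _×_; _,_; proj₁; proj₂)
open import Data.Product.Function.NonDependent.Propositional using (_×-↔_)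
open import Data.Sum.Base using (_⊎_; inj₁; inj₂; [_,_]′)
open import Data.Vec.Base
  using ([]; _∷_; there; tail; lookup; insertAt; removeAt; uncons)
open import Data.Vec.Properties
  using ( lookup-++ˡ; lookup-++ʳ; []=⇒lookup; lookup⇒[]=; ++-injectiveˡ; ∷-injectiveʳ
        ; insertAt-lookup; removeAt-insertAt; insertAt-removeAt )
open import Function.Base using (_∘_)
open import Function.Bundles using (_↔_; mk↔ₛ′; Injection; Inverse; Bijection; Equivalence)
open import Function.Definitions using (Injective)
open import Function.Properties.Inverse using (↔-sym; ↔-trans; Inverse⇒Injection)
open import Relation.Binary.PropositionalEquality
  using (_≡_; _≢_; refl; sym; trans; cong; subst; module ≡-Reasoning)
open import Relation.Nullary.Decidable using (yes; no)
open import Relation.Nullary.Negation using (contradiction)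
open import Relation.Unary using (_∪_) renaming (_∈_ to _∈ₛ_)

private
  variable
    m n k : ℕ
    P Q : ℕ → Set

-- Parity classes of natural numbers.

record IsParity (P : ℕ → Set) : Set where
  field
    total     : ∀ n → P n ⊎ P (suc n)
    exclusive : ∀ n → P n → ¬ P (suc n)

even-isParity : IsParity (2 ∣_)
even-isParity = record { total = total ; exclusive = exclusive }
  where
  total : ∀ n → (2 ∣ n) ⊎ (2 ∣ suc n)
  total 0       = inj₁ (2 ∣0)
  total (suc n) = [ inj₂ ∘ ∣m∣n⇒∣m+n ∣-refl , inj₁ ]′ (total n)

  exclusive : ∀ n → 2 ∣ n → 2 ∤ suc n
  exclusive n 2∣n 2∣1+n with () ← ∣1⇒≡1 (∣m+n∣m⇒∣n (subst (2 ∣_) (+-comm 1 n) 2∣1+n) 2∣n)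

odd-isParity : IsParity (2 ∤_)
odd-isParity = record { total = total ; exclusive = exclusive }
  where
  module Even = IsParity even-isParity

  total : ∀ n → 2 ∤ n ⊎ 2 ∤ suc n
  total n with 2 ∣? n
  ... | yes 2∣n = inj₂ (Even.exclusive n 2∣n)
  ... | no  2∤n = inj₁ 2∤n

  exclusive : ∀ n → 2 ∤ n → ¬ 2 ∤ suc n
  exclusive n 2∤n 2∤1+n = [ 2∤n , 2∤1+n ]′ (Even.total n)

-- The parity is a parameter so that one counting argument serves both systems, with `P` odd for the
-- source and even for the target. At `2 ∤_` and `2 ∣_` this is `𝓜₁` and `𝓜₂` definitionally.
𝓜[_] : (ℕ → Set) → ∀ m → SetSystem (m + m)
𝓜[ P ] m = (λ S → ∃ λ (J : Subset m) → P ∣ J ∣ × S ≡ F J) ∪ 𝓖 m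

-- Subsets: deletion, insertion and enumeration.

x∉p-x : (p : Subset n) (x : Fin n) → x ∉ p - x
x∉p-x (_ ∷ _) zero    ()
x∉p-x (_ ∷ p) (suc x) (there x∈) = x∉p-x p x x∈

p-y⊆p : (p : Subset n) (y : Fin n) → p - y ⊆ p
p-y⊆p p y = p─q⊆p p ⁅ y ⁆

∣insertAt∣ : (p : Subset n) (x : Fin (suc n)) (b : Bool) → ∣ insertAt p x b ∣ ≡ ∣ b ∷ p ∣
∣insertAt∣ p             zero    b       = refl
∣insertAt∣ (inside  ∷ p) (suc x) inside  = cong suc (∣insertAt∣ p x inside)
∣insertAt∣ (inside  ∷ p) (suc x) outside = cong suc (∣insertAt∣ p x outside)
∣insertAt∣ (outside ∷ p) (suc x) inside  = ∣insertAt∣ p x inside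
∣insertAt∣ (outside ∷ p) (suc x) outside = ∣insertAt∣ p x outside

insertAt-removeAt-outside : (p : Subset (suc n)) (x : Fin (suc n)) → x ∉ p →
                            insertAt (removeAt p x) x outside ≡ p
insertAt-removeAt-outside p x x∉p with lookup p x in eq | insertAt-removeAt p x
... | inside  | _  = contradiction (lookup⇒[]= x p eq) x∉p
... | outside | p≡ = p≡

∣removeAt∣ : (p : Subset (suc n)) (x : Fin (suc n)) → x ∉ p → ∣ removeAt p x ∣ ≡ ∣ p ∣
∣removeAt∣ p x x∉p = trans (sym (∣insertAt∣ (removeAt p x) x outside))
                           (cong ∣_∣ (insertAt-removeAt-outside p x x∉p))

-- Brings subsets into `Fin`, where the pigeonhole principle `injective⇒≤` applies: `decode`
-- supplies free choices, `encode` records them.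
Subset↔Fin : ∀ n → Subset n ↔ Fin (2 ^ n)
Subset↔Fin 0       = mk↔ₛ′ (λ _ → zero) (λ _ → []) (λ { zero → refl ; (suc ()) }) (λ { [] → refl })
Subset↔Fin (suc n) = ↔-trans
  (mk↔ₛ′ uncons (λ (b , p) → b ∷ p) (λ _ → refl) (λ { (_ ∷ _) → refl }))
  (↔-trans (↔-sym 2↔Bool ×-↔ Subset↔Fin n) (↔-sym *↔×))

module _ (n : ℕ) where
  open Inverse (Subset↔Fin n) public using () renaming (to to encode; from to decode)

  encode-injective : Injective _≡_ _≡_ encode
  encode-injective = Injection.injective (Inverse⇒Injection (Subset↔Fin n))

  decode-injective : Injective _≡_ _≡_ decode
  decode-injective = Injection.injective (Inverse⇒Injection (↔-sym (Subset↔Fin n)))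

-- Membership in the blocks `F J` and `G p`, and their distinctness.

orig≢primed : (p q : Fin m) → orig p ≢ primed q
orig≢primed {m} p q eq
  with () ← trans (sym (splitAt-↑ˡ m p m)) (trans (cong (splitAt m) eq) (splitAt-↑ʳ m m q))

orig-or-primed : ∀ m (x : Fin (m + m)) → (∃[ p ] orig {m} p ≡ x) ⊎ (∃[ p ] primed {m} p ≡ x)
orig-or-primed m x with splitAt m x in eq
... | inj₁ p = inj₁ (p , splitAt⁻¹-↑ˡ eq)
... | inj₂ p = inj₂ (p , splitAt⁻¹-↑ʳ eq)

orig∈F⁺ : (J : Subset m) {p : Fin m} → p ∈ J → orig p ∈ F J
orig∈F⁺ J {p} p∈ = lookup⇒[]= _ _ (trans (lookup-++ˡ J (∁ J) p) ([]=⇒lookup p∈))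

orig∈F⁻ : (J : Subset m) {p : Fin m} → orig p ∈ F J → p ∈ J
orig∈F⁻ J {p} p∈ = lookup⇒[]= _ _ (trans (sym (lookup-++ˡ J (∁ J) p)) ([]=⇒lookup p∈))

primed∈F⁺ : (J : Subset m) {p : Fin m} → p ∉ J → primed p ∈ F J
primed∈F⁺ J {p} p∉ =
  lookup⇒[]= _ _ (trans (lookup-++ʳ J (∁ J) p) ([]=⇒lookup (x∉p⇒x∈∁p p∉)))

primed∈F⁻ : (J : Subset m) {p : Fin m} → primed p ∈ F J → p ∉ J
primed∈F⁻ J {p} p∈ =
  x∈∁p⇒x∉p (lookup⇒[]= _ _ (trans (sym (lookup-++ʳ J (∁ J) p)) ([]=⇒lookup p∈)))

F-injective : (J K : Subset m) → F J ≡ F K → J ≡ K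
F-injective J K = ++-injectiveˡ J K

orig∉G : (p : Fin m) → orig p ∉ G p
orig∉G p = x∉p-x ⊤ (orig p) ∘ p-y⊆p (⊤ - orig p) (primed p)
         ∘ p-y⊆p (⊤ - orig p - primed p) (primed (next p))

primed∉G : (p : Fin m) → primed p ∉ G p
primed∉G p = x∉p-x (⊤ - orig p) (primed p) ∘ p-y⊆p (⊤ - orig p - primed p) (primed (next p))

primed-next∉G : (p : Fin m) → primed (next p) ∉ G p
primed-next∉G p = x∉p-x (⊤ - orig p - primed p) (primed (next p))

orig∈G : {p q : Fin m} → q ≢ p → orig q ∈ G p
orig∈G {m} {p} {q} q≢p =
  x∈p∧x≢y⇒x∈p-y (x∈p∧x≢y⇒x∈p-y (x∈p∧x≢y⇒x∈p-y ∈⊤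
    (q≢p ∘ ↑ˡ-injective m q p)) (orig≢primed q p)) (orig≢primed q (next p))

orig∉G⁻ : {p q : Fin m} → orig q ∉ G p → q ≡ p
orig∉G⁻ {p = p} {q} q∉ with q ≟ p
... | yes q≡p = q≡p
... | no  q≢p = contradiction (orig∈G q≢p) q∉

G-injective : (p q : Fin m) → G p ≡ G q → p ≡ q
G-injective p q eq = orig∉G⁻ (subst (orig p ∉_) eq (orig∉G p))

F≢G : (J : Subset m) (p : Fin m) → F J ≢ G p
F≢G J p eq with p ∈? J
... | yes p∈J = orig∉G p (subst (orig p ∈_) eq (orig∈F⁺ J p∈J))
... | no  p∉J = primed∉G p (subst (primed p ∈_) eq (primed∈F⁺ J p∉J))

-- The cyclic predecessor.

prev : Fin m → Fin m
prev {suc n} zero    = fromℕ n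
prev {suc n} (suc p) = inject₁ p

next-prev : (p : Fin m) → next (prev p) ≡ p
next-prev {suc n} p = toℕ-injective
  (trans (toℕ-fromℕ< (m%n<n (suc (toℕ (prev p))) (suc n))) (toℕ-next-prev p))
  where
  toℕ-next-prev : ∀ p → suc (toℕ (prev p)) % suc n ≡ toℕ p
  toℕ-next-prev zero    rewrite toℕ-fromℕ n = n%n≡0 (suc n)
  toℕ-next-prev (suc p) rewrite toℕ-inject₁ p = m<n⇒m%n≡m (s≤s (toℕ<n p))

-- The size `2 + n` matters: on one point `prev` is the identity. This is what makes `G p` and
-- `G (prev p)` two blocks.
prev≢id : (p : Fin (2 + n)) → prev p ≢ p
prev≢id zero    ()
prev≢id (suc p) eq = 1+n≰n (≤-reflexive (trans (sym (cong toℕ eq)) (toℕ-inject₁ p)))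

-- Counting the blocks that avoid a given element.

module _ (P-parity : IsParity P) where
  open IsParity P-parity

  -- The `suc` accounts for the element `p` that `parityCompletion∋p` inserts afterwards.
  parityBit : (t : Subset n) → ∃[ b ] P (suc ∣ b ∷ t ∣)
  parityBit t = [ outside ,_ , inside ,_ ]′ (total (suc ∣ t ∣))

  parityBit-unique : {b c : Bool} (t : Subset n) → P ∣ b ∷ t ∣ → P ∣ c ∷ t ∣ → b ≡ c
  parityBit-unique {b = inside}  {inside}  t Pb Pc = refl
  parityBit-unique {b = inside}  {outside} t Pb Pc = contradiction Pb (exclusive ∣ t ∣ Pc)
  parityBit-unique {b = outside} {inside}  t Pb Pc = contradiction Pc (exclusive ∣ t ∣ Pb)
  parityBit-unique {b = outside} {outside} t Pb Pc = refl

  module _ (p : Fin (2 + k)) where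

    parityCompletion∋p : Fin (2 ^ k) → Subset (2 + k)
    parityCompletion∋p i = insertAt (proj₁ (parityBit (decode k i)) ∷ decode k i) p inside

    -- With m = 2 + k, this gives a lower bound on the blocks missing `primed p`. For `F J` that
    -- means `p ∈ J`, which leaves k free bits and one bit dictated by parity.
    avoidsPrimed : Fin (2 + 2 ^ k) → Subset ((2 + k) + (2 + k))
    avoidsPrimed 0F            = G p
    avoidsPrimed 1F            = G (prev p)
    avoidsPrimed (suc (suc i)) = F (parityCompletion∋p i)

    avoidsPrimed∈𝓜 : ∀ i → avoidsPrimed i ∈ₛ 𝓜[ P ] (2 + k)
    avoidsPrimed∈𝓜 0F            = inj₂ (p , refl)
    avoidsPrimed∈𝓜 1F            = inj₂ (prev p , refl)
    avoidsPrimed∈𝓜 (suc (suc i)) = inj₁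
      ( parityCompletion∋p i
      , subst P (sym (∣insertAt∣ (_ ∷ decode k i) p inside)) (proj₂ (parityBit (decode k i)))
      , refl )

    primed∉avoidsPrimed : ∀ i → primed p ∉ avoidsPrimed i
    primed∉avoidsPrimed 0F            = primed∉G p
    primed∉avoidsPrimed 1F            =
      subst (λ q → primed q ∉ G (prev p)) (next-prev p) (primed-next∉G (prev p))
    primed∉avoidsPrimed (suc (suc i)) p∈ =
      primed∈F⁻ (parityCompletion∋p i) p∈ (lookup⇒[]= p _ (insertAt-lookup (_ ∷ decode k i) p inside))

    avoidsPrimed-injective : Injective _≡_ _≡_ avoidsPrimed
    avoidsPrimed-injective {0F}          {0F}          eq = refl
    avoidsPrimed-injective {0F}          {1F}          eq = contradiction (sym (G-injective _ _ eq)) (prev≢id p)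
    avoidsPrimed-injective {0F}          {suc (suc j)} eq = contradiction (sym eq) (F≢G (parityCompletion∋p j) p)
    avoidsPrimed-injective {1F}          {0F}          eq = contradiction (G-injective _ _ eq) (prev≢id p)
    avoidsPrimed-injective {1F}          {1F}          eq = refl
    avoidsPrimed-injective {1F}          {suc (suc j)} eq = contradiction (sym eq) (F≢G (parityCompletion∋p j) (prev p))
    avoidsPrimed-injective {suc (suc i)} {0F}          eq = contradiction eq (F≢G (parityCompletion∋p i) p)
    avoidsPrimed-injective {suc (suc i)} {1F}          eq = contradiction eq (F≢G (parityCompletion∋p i) (prev p))
    avoidsPrimed-injective {suc (suc i)} {suc (suc j)} eq =
      -- Removing `p` undoes the insertion; dropping the parity bit then leaves the free bits.
      cong (λ l → suc (suc l)) (decode-injective k (∷-injectiveʳ (begin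
        proj₁ (parityBit (decode k i)) ∷ decode k i  ≡⟨ removeAt-insertAt _ p inside ⟨
        removeAt (parityCompletion∋p i) p            ≡⟨ cong (λ J → removeAt J p)
                                                          (F-injective (parityCompletion∋p i)
                                                                       (parityCompletion∋p j) eq) ⟩
        removeAt (parityCompletion∋p j) p            ≡⟨ removeAt-insertAt _ p inside ⟩
        proj₁ (parityBit (decode k j)) ∷ decode k j  ∎)))
      where open ≡-Reasoning

  module _ (q : Fin (2 + k)) where

    -- The upper bound for blocks missing `orig q`, one below the bound for `primed p`. All `G r`
    -- can share a code, since missing `orig q` forces `r ≡ q`. For `F K` the bit at `q` is then
    -- known and the first remaining bit follows from parity, so neither is recorded.
    code : ∀ {S} → S ∈ₛ 𝓜[ P ] (2 + k) → Fin (1 + 2 ^ k)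
    code (inj₁ (K , _)) = suc (encode k (tail (removeAt K q)))
    code (inj₂ _)       = zero

    tail-removeAt-injective : {K L : Subset (2 + k)} → q ∉ K → q ∉ L → P ∣ K ∣ → P ∣ L ∣ →
                              tail (removeAt K q) ≡ tail (removeAt L q) → K ≡ L
    tail-removeAt-injective {K} {L} q∉K q∉L PK PL eq = begin
      K                                  ≡⟨ insertAt-removeAt-outside K q q∉K ⟨
      insertAt (removeAt K q) q outside  ≡⟨ cong (λ J → insertAt J q outside)
                                              (rest (removeAt K q) (removeAt L q) eq
                                                (subst P (sym (∣removeAt∣ K q q∉K)) PK)
                                                (subst P (sym (∣removeAt∣ L q q∉L)) PL)) ⟩
      insertAt (removeAt L q) q outside  ≡⟨ insertAt-removeAt-outside L q q∉L ⟩
      L                                  ∎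
      where
      open ≡-Reasoning
      rest : (s t : Subset (1 + k)) → tail s ≡ tail t → P ∣ s ∣ → P ∣ t ∣ → s ≡ t
      -- Once the tail is fixed, only one head gives a size satisfying `P`.
      rest (_ ∷ s) (_ ∷ .s) refl Ps Pt = cong (_∷ s) (parityBit-unique s Ps Pt)

    code-injective : ∀ {S T} (S∈ : S ∈ₛ 𝓜[ P ] (2 + k)) (T∈ : T ∈ₛ 𝓜[ P ] (2 + k)) →
                     orig q ∉ S → orig q ∉ T → code S∈ ≡ code T∈ → S ≡ T
    code-injective (inj₁ (K , PK , refl)) (inj₁ (L , PL , refl)) q∉S q∉T eq =
      cong F (tail-removeAt-injective (q∉S ∘ orig∈F⁺ K) (q∉T ∘ orig∈F⁺ L) PK PL
        (encode-injective k (suc-injective eq)))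
    code-injective (inj₂ (r , refl)) (inj₂ (s , refl)) q∉S q∉T eq =
      cong G (trans (sym (orig∉G⁻ q∉S)) (orig∉G⁻ q∉T))

-- Images of blocks under an injection of the ground set.

image-injective : {f : Fin n → Fin k} → Injective _≡_ _≡_ f → Injective _≡_ _≡_ (image f)
image-injective {f = f} f-inj {S} {T} eq = ⊆-antisym (half S T eq) (half T S (sym eq))
  where
  half : ∀ S T → image f S ≡ image f T → S ⊆ T
  half S T eq x∈S
    with y , y∈T , fy≡fx ← Equivalence.to (∈-image f T)
           (subst (_ ∈_) eq (Equivalence.from (∈-image f S) (_ , x∈S , refl)))
    = subst (_∈ T) (f-inj fy≡fx) y∈T

module _ {σ : Fin (m + m) → Fin (m + m)} (σ-injective : Injective _≡_ _≡_ σ) where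

  -- Otherwise the `2 + 2 ^ k` blocks of `avoidsPrimed` would have distinct images missing `orig q`,
  -- for which there are only `1 + 2 ^ k` codes.
  primed↦orig-absurd : 3 ≤ m → IsParity P → IsParity Q →
    (∀ {S} → S ∈ₛ 𝓜[ P ] m → image σ S ∈ₛ 𝓜[ Q ] m) →
    (p q : Fin m) → σ (primed p) ≢ orig q
  primed↦orig-absurd (s≤s (s≤s _)) P-parity Q-parity σ-maps p q σp′≡q =
    1+n≰n (injective⇒≤ inj)
    where
    block : Fin _ → Subset _
    block = avoidsPrimed P-parity p

    q∉image : ∀ i → orig q ∉ image σ (block i)
    -- By injectivity only `primed p` is sent to `orig q`, and the block misses it.
    q∉image i q∈ with x , x∈ , σx≡q ← Equivalence.to (∈-image σ (block i)) q∈ =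
      primed∉avoidsPrimed P-parity p i
        (subst (_∈ block i) (σ-injective (trans σx≡q (sym σp′≡q))) x∈)

    inj : Injective _≡_ _≡_ (λ i → code Q-parity q (σ-maps (avoidsPrimed∈𝓜 P-parity p i)))
    inj {i} {j} eq = avoidsPrimed-injective P-parity p (image-injective σ-injective
      (code-injective Q-parity q _ _ (q∉image i) (q∉image j) eq))

  -- The images of the m primed elements already fill all m primed places.
  orig↦primed-absurd : (∀ (p q : Fin m) → σ (primed p) ≢ orig q) →
                       (p q : Fin m) → σ (orig p) ≢ primed q
  orig↦primed-absurd σ-primed p q σp≡q′ = 1+n≰n (injective⇒≤ inj)
    where
    σ′ : (i : Fin m) → ∃[ j ] primed {m} j ≡ σ (primed i)
    σ′ i with orig-or-primed m (σ (primed i))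
    ... | inj₁ (j , eq) = contradiction (sym eq) (σ-primed i j)
    ... | inj₂ w        = w

    -- The extra index `zero` stands for `orig p`, the others for the primed elements.
    f : Fin (suc m) → Fin m
    f zero    = q
    f (suc i) = proj₁ (σ′ i)

    q≢σ′ : (i : Fin m) → q ≢ proj₁ (σ′ i)
    q≢σ′ i eq = orig≢primed p i
      (σ-injective (trans σp≡q′ (trans (cong primed eq) (proj₂ (σ′ i)))))

    inj : Injective _≡_ _≡_ f
    inj {zero}  {zero}  eq = refl
    inj {zero}  {suc j} eq = contradiction eq (q≢σ′ j)
    inj {suc i} {zero}  eq = contradiction (sym eq) (q≢σ′ i)
    inj {suc i} {suc j} eq = cong suc (↑ʳ-injective m i j
      (σ-injective (trans (sym (proj₂ (σ′ i))) (trans (cong primed eq) (proj₂ (σ′ j))))))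

-- A block of the odd system with no possible image.

proposition3p13 : (m : ℕ) → 3 ≤ m → ¬ Isomorphic (𝓜₁ m) (𝓜₂ m)
proposition3p13 m@(suc (suc (suc _))) 3≤m@(s≤s (s≤s (s≤s _))) (σ⤖ , σ𝓜₁⊆𝓜₂ , _) =
  image∉𝓜₂ (σ-maps block∈𝓜₁)
  where
  open Bijection σ⤖ using () renaming (to to σ; injective to σ-injective)

  e : Fin m
  e = zero

  block : Subset (m + m)
  block = F ⁅ e ⁆

  2∤∣⁅x⁆∣ : (x : Fin m) → 2 ∤ ∣ ⁅ x ⁆ ∣
  2∤∣⁅x⁆∣ x 2∣ with () ← ∣1⇒≡1 (subst (2 ∣_) (∣⁅x⁆∣≡1 x) 2∣)

  block∈𝓜₁ : block ∈ₛ 𝓜₁ m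
  block∈𝓜₁ = inj₁ (⁅ e ⁆ , 2∤∣⁅x⁆∣ e , refl)

  σ-maps : ∀ {S} → S ∈ₛ 𝓜₁ m → image σ S ∈ₛ 𝓜₂ m
  σ-maps S∈ = σ𝓜₁⊆𝓜₂ (_ , S∈ , refl)

  σ-primed : (p q : Fin m) → σ (primed p) ≢ orig q
  σ-primed = primed↦orig-absurd σ-injective 3≤m odd-isParity even-isParity σ-maps

  σ-orig : ∃[ q ] orig {m} q ≡ σ (orig e)
  σ-orig with orig-or-primed m (σ (orig e))
  ... | inj₁ w        = w
  ... | inj₂ (q , eq) = contradiction (sym eq) (orig↦primed-absurd σ-injective σ-primed e q)

  q₀ : Fin m
  q₀ = proj₁ σ-orig

  orig∈image⁺ : orig q₀ ∈ image σ block
  orig∈image⁺ = Equivalence.from (∈-image σ block)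
    (orig e , orig∈F⁺ ⁅ e ⁆ (x∈⁅x⁆ e) , sym (proj₂ σ-orig))

  orig∈image⁻ : {q : Fin m} → orig q ∈ image σ block → q ≡ q₀
  orig∈image⁻ {q} q∈ with Equivalence.to (∈-image σ block) q∈
  ... | x , x∈ , σx≡q with orig-or-primed m x
  -- No primed element reaches an unprimed one, so the preimage is the only unprimed element of
  -- `block`, namely `orig e`.
  ...   | inj₂ (p , refl) = contradiction σx≡q (σ-primed p q)
  ...   | inj₁ (p , refl) with refl ← x∈⁅y⁆⇒x≡y e (orig∈F⁻ ⁅ e ⁆ x∈) =
    ↑ˡ-injective m q q₀ (trans (sym σx≡q) (sym (proj₂ σ-orig)))

  image∉𝓜₂ : ¬ (image σ block ∈ₛ 𝓜₂ m)
  image∉𝓜₂ (inj₁ (K , 2∣∣K∣ , eq)) = 2∤∣⁅x⁆∣ q₀ (subst ((2 ∣_) ∘ ∣_∣) K≡⁅q₀⁆ 2∣∣K∣)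
    where
    K≡⁅q₀⁆ : K ≡ ⁅ q₀ ⁆
    K≡⁅q₀⁆ = ⊆-antisym
      (λ x∈K → subst (_∈ ⁅ q₀ ⁆)
        (sym (orig∈image⁻ (subst (_ ∈_) (sym eq) (orig∈F⁺ K x∈K)))) (x∈⁅x⁆ q₀))
      (λ x∈⁅q₀⁆ → subst (_∈ K) (sym (x∈⁅y⁆⇒x≡y q₀ x∈⁅q₀⁆))
        (orig∈F⁻ K (subst (_ ∈_) eq orig∈image⁺)))
  image∉𝓜₂ (inj₂ (p , eq)) =
    -- As m is at least 3, `punchIn p` yields two distinct indices other than `p`. Both would be
    -- unprimed elements of the image, which has only one.
    contradiction (punchIn-injective p 0F 1F (trans (≡q₀ 0F) (sym (≡q₀ 1F)))) λ ()
    where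
    ≡q₀ : ∀ j → punchIn p j ≡ q₀
    ≡q₀ j = orig∈image⁻ (subst (orig (punchIn p j) ∈_) (sym eq) (orig∈G (punchInᵢ≢i p j)))
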